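{- Let $k\ge 3$ be an integer. Then $W_c(k,2)>k(k-1)$.
   Context: For positive integers $k,N,d$ with $k\ge 3$, a $k$-term cyclic arithmetic progression mod $N$ with common difference $d$ is a $k$-element subset of $\mathbb{Z}_N=\mathbb{Z}/N\mathbb{Z}$ of the form $\{t,t+d,\ldots,t+(k-1)d\}$ for some $t\in\mathbb{Z}_N$ (so these $k$ elements are pairwise distinct mod $N$). An $r$-coloring of a set $S$ is a map $c:S\to\{1,\ldots,r\}$; a subset of $S$ is monochromatic if $c$ is constant on it. For integers $k\ge 3$, $r\ge 2$, the cyclic Van der Waerden number $W_c(k,r)$ is the smallest modulus $N$ such that for all positive integers $M\ge N$ and every $r$-coloring of $\mathbb{Z}_M$, there exists a monochromatic $k$-term cyclic arithmetic progression mod $M$ in $\mathbb{Z}_M$. (This number always exists.) -}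

module Defs where

open import Data.Nat using (ℕ; NonZero; _+_; _*_; _≤_)
open import Data.Nat.DivMod using (_mod_)
open import Data.Fin using (Fin; toℕ)
open import Data.Fin.Subset using (Subset; _∈_; ∣_∣)
open import Data.Product using (_×_; ∃-syntax)
open import Function.Bundles using (_⇔_)
open import Relation.Binary.PropositionalEquality using (_≡_)

-- ℤ/Nℤ is represented by its least non-negative residues.
ℤmod : ℕ → Set
ℤmod N = Fin N

-- The class of t + i d modulo N.
term : (N : ℕ) .{{_ : NonZero N}} → ℤmod N → (d i : ℕ) → ℤmod N
term N t d i = (toℕ t + i * d) mod N

-- S = {t, t + d, …, t + (k - 1) d} for some t, and S has exactly k elements:
-- the cardinality condition is what makes the k terms pairwise distinct.
IsCyclicAP : (k N d : ℕ) .{{_ : NonZero N}} → Subset N → Set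
IsCyclicAP k N d S =
  ∣ S ∣ ≡ k ×
  (∃[ t ] (∀ x → (x ∈ S) ⇔ (∃[ i ] x ≡ term N t d (toℕ {k} i))))

Coloring : (r N : ℕ) → Set
Coloring r N = ℤmod N → Fin r

Monochromatic : ∀ {r N} → Coloring r N → Subset N → Set
Monochromatic c S = ∀ {x y} → x ∈ S → y ∈ S → c x ≡ c y

HasMonochromaticCyclicAP : (k : ℕ) {r : ℕ} (M : ℕ) .{{_ : NonZero M}} →
                           Coloring r M → Set
HasMonochromaticCyclicAP k M c =
  ∃[ d ] ∃[ S ] NonZero d × IsCyclicAP k M d S × Monochromatic c S

IsCyclicVdWBound : (k r N : ℕ) → Set
IsCyclicVdWBound k r N =
  (M : ℕ) .{{_ : NonZero M}} → N ≤ M →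
  (c : Coloring r M) → HasMonochromaticCyclicAP k M c

-- "N = W_c(k, r)".  The number is given by its defining property, as a
-- relation, because computing it as a function would need van der Waerden's
-- theorem for its existence.
record IsCyclicVdWNumber (k r N : ℕ) : Set where
  field
    positive : NonZero N
    bound    : IsCyclicVdWBound k r N
    least    : (N′ : ℕ) → NonZero N′ → IsCyclicVdWBound k r N′ → N ≤ N′

-- Colour x ∈ ℤ/k(k-1) by whether x mod k lies in the lower half of [0, k).
-- If k ∤ d, put g = gcd(d, k) < k: modulo k, the terms of a k-term progression
-- run over a whole coset of gℤ/kℤ.  This coset contains an element below
-- g ≤ k/2 and an element at least k - g ≥ k/2, so both colours occur.
-- If k ∣ d, the progression repeats after k - 1 steps, so it has fewer than k
-- elements.
{-# OPTIONS --safe #-}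
module Submission where

open import Defs
open import Data.Nat using (ℕ; zero; suc; _+_; _*_; _∸_; _≤_; _<_; _>_; NonZero; ≢-nonZero⁻¹; z≤n; s≤s; _<?_)
open import Data.Nat.Properties
open import Data.Nat.DivMod
open import Data.Nat.Divisibility using (_∣_; _∤_; _∣?_; divides; m∣m*n)
open import Data.Nat.GCD using (module Bézout; GCD)
open import Data.Nat.Tactic.RingSolver using (solve-∀)
open import Data.Fin using (Fin; zero; suc; toℕ)
open import Data.Fin.Properties using (toℕ-fromℕ<; toℕ-injective)
open import Data.Fin.Subset using (Subset; inside; outside; _∪_; ⁅_⁆; ⊥; ∣_∣; _∈_)
open import Data.Fin.Subset.Properties
  using (∣⊥∣≡0; ∪-identityˡ; x∈⁅x⁆; p⊆q⇒∣p∣≤∣q∣; p⊆p∪q; q⊆p∪q)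
open import Data.Vec using (_∷_)
open import Data.Product using (_×_; _,_; ∃-syntax)
open import Function.Bundles using (Equivalence)
open import Relation.Nullary using (¬_; yes; no; contradiction)
open import Relation.Binary.PropositionalEquality
  using (_≡_; refl; sym; trans; cong; subst; module ≡-Reasoning)

∣⁅x⁆∪p∣≤1+∣p∣ : ∀ {n} (x : Fin n) (p : Subset n) → ∣ ⁅ x ⁆ ∪ p ∣ ≤ suc ∣ p ∣
∣⁅x⁆∪p∣≤1+∣p∣ zero    (inside  ∷ p) rewrite ∪-identityˡ p = n≤1+n _
∣⁅x⁆∪p∣≤1+∣p∣ zero    (outside ∷ p) rewrite ∪-identityˡ p = ≤-refl
∣⁅x⁆∪p∣≤1+∣p∣ (suc x) (inside  ∷ p) = s≤s (∣⁅x⁆∪p∣≤1+∣p∣ x p)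
∣⁅x⁆∪p∣≤1+∣p∣ (suc x) (outside ∷ p) = ∣⁅x⁆∪p∣≤1+∣p∣ x p

-- Built from singletons so that each of the m values raises the cardinality by at most one.
image : ∀ {m n} → (Fin m → Fin n) → Subset n
image {zero}  f = ⊥
image {suc m} f = ⁅ f zero ⁆ ∪ image (λ i → f (suc i))

∣image∣≤m : ∀ {m n} (f : Fin m → Fin n) → ∣ image f ∣ ≤ m
∣image∣≤m {zero}  {n} f = ≤-reflexive (∣⊥∣≡0 n)
∣image∣≤m {suc m} f =
  ≤-trans (∣⁅x⁆∪p∣≤1+∣p∣ (f zero) _) (s≤s (∣image∣≤m (λ i → f (suc i))))

f[i]∈image : ∀ {m n} (f : Fin m → Fin n) i → f i ∈ image f
f[i]∈image f zero    = p⊆p∪q _ (x∈⁅x⁆ (f zero))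
f[i]∈image f (suc i) = q⊆p∪q ⁅ f zero ⁆ _ (f[i]∈image (λ j → f (suc j)) i)

-- Multiples of n are added on both sides, so that congruences can be proved in ℕ without
-- subtraction.
m+kn≡o+ln⇒m%n≡o%n : ∀ {m o} k l n .{{_ : NonZero n}} →
                    m + k * n ≡ o + l * n → m % n ≡ o % n
m+kn≡o+ln⇒m%n≡o%n {m} {o} k l n eq = begin
  m % n           ≡⟨ [m+kn]%n≡m%n m k n ⟨
  (m + k * n) % n ≡⟨ cong (_% n) eq ⟩
  (o + l * n) % n ≡⟨ [m+kn]%n≡m%n o l n ⟩
  o % n           ∎
  where open ≡-Reasoning

toℕ-mod : ∀ m n .{{_ : NonZero n}} → toℕ (m mod n) ≡ m % n
toℕ-mod m n = toℕ-fromℕ< (m%n<n m n)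

-- Split i as `i % p + i / p * p`: the second summand contributes `i / p * (p * d)`, a multiple of
-- N.
term-%-period : ∀ {N} .{{_ : NonZero N}} t {d} p .{{_ : NonZero p}} →
                N ∣ p * d → ∀ i → term N t d i ≡ term N t d (i % p)
term-%-period {N} t {d} p (divides q pd≡qN) i = toℕ-injective (begin
  toℕ (term N t d i)                ≡⟨ toℕ-mod (toℕ t + i * d) N ⟩
  (toℕ t + i * d) % N               ≡⟨ m+kn≡o+ln⇒m%n≡o%n 0 (i / p * q) N shift ⟩
  (toℕ t + i % p * d) % N           ≡⟨ toℕ-mod (toℕ t + i % p * d) N ⟨
  toℕ (term N t d (i % p))          ∎)
  where
  open ≡-Reasoning
  rearrange : ∀ t r s p d → t + (r + s * p) * d + 0 ≡ t + r * d + s * (p * d)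
  rearrange = solve-∀
  shift : toℕ t + i * d + 0 * N ≡ toℕ t + i % p * d + i / p * q * N
  shift = begin
    toℕ t + i * d + 0                         ≡⟨ cong (λ j → toℕ t + j * d + 0) (m≡m%n+[m/n]*n i p) ⟩
    toℕ t + (i % p + i / p * p) * d + 0       ≡⟨ rearrange (toℕ t) (i % p) (i / p) p d ⟩
    toℕ t + i % p * d + i / p * (p * d)       ≡⟨ cong (λ e → toℕ t + i % p * d + i / p * e) pd≡qN ⟩
    toℕ t + i % p * d + i / p * (q * N)       ≡⟨ cong (toℕ t + i % p * d +_) (*-assoc (i / p) q N) ⟨
    toℕ t + i % p * d + i / p * q * N         ∎

-- Every term already occurs among the first p, so S lies in the image of a map from `Fin p`; the
-- cardinality condition then gives k ≤ p.
cyclicAP-period : ∀ {k N d} .{{_ : NonZero N}} {S : Subset N} p .{{_ : NonZero p}} →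
                  IsCyclicAP k N d S → N ∣ p * d → k ≤ p
cyclicAP-period {k} {N} {d} {S} p (∣S∣≡k , t , S⇔) N∣pd = begin
  k                                     ≡⟨ ∣S∣≡k ⟨
  ∣ S ∣                                 ≤⟨ p⊆q⇒∣p∣≤∣q∣ S⊆image ⟩
  ∣ image residueTerm ∣                 ≤⟨ ∣image∣≤m residueTerm ⟩
  p                                     ∎
  where
  open ≤-Reasoning
  residueTerm : Fin p → ℤmod N
  residueTerm i = term N t d (toℕ i)
  S⊆image : ∀ {x} → x ∈ S → x ∈ image residueTerm
  S⊆image {x} x∈S with i , x≡ ← Equivalence.to (S⇔ x) x∈S =
    subst (_∈ image residueTerm)
      (sym (trans x≡ (trans (term-%-period t p N∣pd (toℕ i))
                            (cong (term N t d) (sym (toℕ-mod (toℕ i) p))))))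
      (f[i]∈image residueTerm (toℕ i mod p))

-- The terms z * k and w * k keep Bézout's identity inside ℕ.
bézout-mod : ∀ {g} d k .{{_ : NonZero k}} → Bézout.Identity g d k →
             ∃[ u ] ∃[ z ] ∃[ w ] u * d + z * k ≡ g + w * k
bézout-mod d k (Bézout.+- x y eq) = x , 0 , y , trans (+-identityʳ (x * d)) (sym eq)
-- Here g + x d = y k, so d has coefficient -x; as n = k - 1, `x * n` represents -x modulo k.
bézout-mod {g} d k@(suc n) (Bézout.-+ x y eq) = x * n , y , x * d , (begin
  x * n * d + y * k       ≡⟨ cong (x * n * d +_) eq ⟨
  x * n * d + (g + x * d) ≡⟨ rearrange x n d g ⟩
  g + x * d * suc n       ∎)
  where
  open ≡-Reasoning
  rearrange : ∀ x n d g → x * n * d + (g + x * d) ≡ g + x * d * suc n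
  rearrange = solve-∀

-- Bézout gives u d ≡ g modulo k, so m u steps of length d advance t by m g. Reducing the number of
-- steps modulo k brings it into `Fin k` and changes the term by a multiple of k.
AP-reaches : ∀ {g} d k .{{_ : NonZero k}} → Bézout.Identity g d k →
             ∀ t m → ∃[ i ] (t + toℕ {k} i * d) % k ≡ (t + m * g) % k
AP-reaches {g} d k b t m with u , z , w , eq ← bézout-mod d k b =
  j mod k , (begin
    (t + toℕ (j mod k) * d) % k ≡⟨ cong (λ i → (t + i * d) % k) (toℕ-mod j k) ⟩
    -- The multiple `j / k * d` pays for reducing j; `m * z` and `m * w` come from Bézout's
    -- identity.
    (t + j % k * d) % k         ≡⟨ m+kn≡o+ln⇒m%n≡o%n (j / k * d + m * z) (m * w) k shift ⟩
    (t + m * g) % k             ∎)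
  where
  open ≡-Reasoning
  j = m * u
  rearrange₁ : ∀ t r s d m z k →
               t + r * d + (s * d + m * z) * k ≡ t + (r + s * k) * d + m * z * k
  rearrange₁ = solve-∀
  rearrange₂ : ∀ t m u d z k → t + m * u * d + m * z * k ≡ t + m * (u * d + z * k)
  rearrange₂ = solve-∀
  rearrange₃ : ∀ t m g w k → t + m * (g + w * k) ≡ t + m * g + m * w * k
  rearrange₃ = solve-∀
  shift : t + j % k * d + (j / k * d + m * z) * k ≡ t + m * g + m * w * k
  shift = begin
    t + j % k * d + (j / k * d + m * z) * k   ≡⟨ rearrange₁ t (j % k) (j / k) d m z k ⟩
    t + (j % k + j / k * k) * d + m * z * k   ≡⟨ cong (λ i → t + i * d + m * z * k) (m≡m%n+[m/n]*n j k) ⟨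
    t + m * u * d + m * z * k                 ≡⟨ rearrange₂ t m u d z k ⟩
    t + m * (u * d + z * k)                   ≡⟨ cong (λ e → t + m * e) eq ⟩
    t + m * (g + w * k)                       ≡⟨ rearrange₃ t m g w k ⟩
    t + m * g + m * w * k                     ∎

-- Quotient 0 would make k zero, and quotient 1 would make k = g a divisor of d. The form h + 2
-- encodes g ≤ k/2.
nontrivialCofactor : ∀ {g k d} .{{_ : NonZero k}} → k ∤ d → GCD d k g →
                     ∃[ h ] k ≡ suc (suc h) * g
nontrivialCofactor {g} {k} {d} k∤d G with GCD.gcd∣n G
... | divides zero          k≡0 = contradiction k≡0 (≢-nonZero⁻¹ k)
... | divides (suc zero)    k≡g =
  contradiction (subst (_∣ d) (sym (trans k≡g (*-identityˡ g))) (GCD.gcd∣m G)) k∤d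
... | divides (suc (suc h)) k≡  = h , k≡

AP-meets-both-halves : ∀ d k .{{_ : NonZero k}} → k ∤ d → ∀ t →
  (∃[ i ] 2 * ((t + toℕ {k} i * d) % k) < k) ×
  (∃[ j ] k ≤ 2 * ((t + toℕ {k} j * d) % k))
AP-meets-both-halves d k k∤d t
  with Bézout.result g G b ← Bézout.lemma d k
  with h , refl ← nontrivialCofactor k∤d G = low , high
  where
  instance
    g≢0 : NonZero g
    -- After matching `refl`, k is (h + 2) g, so its positivity passes to g.
    g≢0 = m*n≢0⇒n≢0 (suc (suc h))
  ρ = t % g
  q = t / g
  ρ<g : ρ < g
  ρ<g = m%n<n t g
  -- The elements of [0, k) congruent to t modulo g run from ρ up to `top`, which is k - g + ρ.
  top : ℕ
  top = ρ + suc h * g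

  top<k : top < k
  top<k = +-monoˡ-< (suc h * g) ρ<g

  2ρ<k : 2 * ρ < k
  2ρ<k = begin-strict
    2 * ρ           <⟨ *-monoʳ-< 2 ρ<g ⟩
    2 * g           ≤⟨ *-monoˡ-≤ g {2} {suc (suc h)} (s≤s (s≤s z≤n)) ⟩
    k               ∎
    where open ≤-Reasoning

  k≤2top : k ≤ 2 * top
  k≤2top = begin
    suc (suc h) * g       ≤⟨ *-monoˡ-≤ g {suc (suc h)} {2 * suc h} lem ⟩
    2 * suc h * g         ≡⟨ *-assoc 2 (suc h) g ⟩
    2 * (suc h * g)       ≤⟨ *-monoʳ-≤ 2 (m≤n+m (suc h * g) ρ) ⟩
    2 * top               ∎
    where
    open ≤-Reasoning
    lem : suc (suc h) ≤ 2 * suc h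
    lem = s≤s (≤-trans (≤-reflexive (+-comm 1 h)) (+-monoʳ-≤ h (s≤s z≤n)))

  reaches : ∀ m r → r < k → t + m * g ≡ r + q * k →
            ∃[ i ] (t + toℕ {k} i * d) % k ≡ r
  reaches m r r<k eq with i , e ← AP-reaches d k b t m =
    i , trans e (trans (cong (_% k) eq) (trans ([m+kn]%n≡m%n r q k) (m<n⇒m%n≡m r<k)))

  rearrange-low : ∀ ρ q g h → ρ + q * g + q * suc h * g ≡ ρ + q * (suc (suc h) * g)
  rearrange-low = solve-∀
  rearrange-high : ∀ ρ q g h →
    ρ + q * g + suc q * suc h * g ≡ ρ + suc h * g + q * (suc (suc h) * g)
  rearrange-high = solve-∀

  low : ∃[ i ] 2 * ((t + toℕ {k} i * d) % k) < k
  -- Since t = ρ + q g, the part q g must be cancelled modulo k; h + 1 ≡ -1 modulo h + 2, so adding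
  -- `q * suc h` copies of g does this and leaves ρ + q k.
  low with i , e ← reaches (q * suc h) ρ (≤-<-trans (m≤m+n ρ (suc h * g)) top<k)
                     (trans (cong (_+ q * suc h * g) (m≡m%n+[m/n]*n t g))
                            (rearrange-low ρ q g h)) =
    i , subst (λ r → 2 * r < k) (sym e) 2ρ<k

  high : ∃[ j ] k ≤ 2 * ((t + toℕ {k} j * d) % k)
  -- Another h + 1 copies of g lead from ρ to `top`.
  high with j , e ← reaches (suc q * suc h) top top<k
                      (trans (cong (_+ suc q * suc h * g) (m≡m%n+[m/n]*n t g))
                             (rearrange-high ρ q g h)) =
    j , subst (λ r → k ≤ 2 * r) (sym e) k≤2top

-- Comparing 2 r with k avoids halving; for odd k the middle residue counts as low.
halfColor : ℕ → ℕ → Fin 2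
halfColor k r with 2 * r <? k
... | yes _ = zero
... | no  _ = suc zero

halfColor-separates : ∀ {k r s} → 2 * r < k → k ≤ 2 * s → ¬ halfColor k r ≡ halfColor k s
halfColor-separates {k} {r} {s} r-low s-high eq with 2 * r <? k | 2 * s <? k
... | yes _    | yes s-low = <⇒≱ s-low s-high
... | no ¬r-low | _      = ¬r-low r-low
halfColor-separates r-low s-high () | yes _ | no _

halfColoring : ∀ k N .{{_ : NonZero k}} → Coloring 2 N
halfColoring k N x = halfColor k (toℕ x % k)

halfColoring-avoids : ∀ k n .{{_ : NonZero k}} .{{_ : NonZero n}} .{{_ : NonZero (k * n)}} →
  n < k → ¬ HasMonochromaticCyclicAP k (k * n) (halfColoring k (k * n))
halfColoring-avoids k n n<k (d , S , _ , ap@(_ , t , S⇔) , mono) with k ∣? d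
... | yes (divides q refl) =
  -- With d = q k, n d = q (k n) vanishes modulo k n, so n is a period and k ≤ n would follow.
  <⇒≱ n<k (cyclicAP-period n ap (divides q (rearrange n q k)))
  where
  rearrange : ∀ n q k → n * (q * k) ≡ q * (k * n)
  rearrange = solve-∀
... | no k∤d with (i , i-low) , (j , j-high) ← AP-meets-both-halves d k k∤d (toℕ t) =
  halfColor-separates
    (subst (λ r → 2 * r < k) (sym (residue i)) i-low)
    (subst (λ r → k ≤ 2 * r) (sym (residue j)) j-high)
    (mono (term∈S i) (term∈S j))
  where
  term∈S : ∀ (i : Fin k) → term (k * n) t d (toℕ i) ∈ S
  term∈S i = Equivalence.from (S⇔ _) (i , refl)
  -- Reduction modulo k n does not affect residues modulo k, as k divides k n.
  residue : ∀ (i : Fin k) → toℕ (term (k * n) t d (toℕ i)) % k ≡ (toℕ t + toℕ i * d) % k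
  residue i = trans (cong (_% k) (toℕ-mod (toℕ t + toℕ i * d) (k * n)))
                    (m∣n⇒o%n%m≡o%m k (k * n) (toℕ t + toℕ i * d) (m∣m*n n))

proposition4p6 : (k : ℕ) → 3 ≤ k →
    (W : ℕ) → IsCyclicVdWNumber k 2 W → W > k * (k ∸ 1)
-- This pattern makes `k ∸ 1` compute to n and shows n to be positive. If W ≤ k n, the bound at
-- modulus k n would contradict the colouring.
proposition4p6 k@(suc n@(suc _)) (s≤s (s≤s _)) W isW = ≰⇒> λ W≤kn →
  halfColoring-avoids k n (n<1+n n)
    (IsCyclicVdWNumber.bound isW (k * n) W≤kn (halfColoring k (k * n)))
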